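{- Let $\Phi$ be a finite integral gain graph. For every $m\in\mathbb{Z}$, the number $\chi^{\mathbb Z}_\Phi(m)$ of proper integral $m$-colorations of $\Phi$ is $$\chi^{\mathbb Z}_\Phi(m)=\sum_{B\in\operatorname{Lat}^{\mathrm b}\Phi}\mu(\varnothing,B)\prod_{W\in\pi(B)}\big[m-h_B(W)\big]^+ ,$$ where $\mu$ is the M\"obius function of $\operatorname{Lat}^{\mathrm b}\Phi$.
   Context: An integral gain graph $\Phi$ consists of a finite graph $(V,E)$ (loops and multiple edges allowed) and a gain function $\varphi$ assigning an integer to each oriented edge, with $\varphi(e^{ -1})=-\varphi(e)$ when $e^{ -1}$ is $e$ with the opposite orientation. The notation $g e_{ij}$ means an edge with endpoints $v_i,v_j$ whose gain in the direction from $v_i$ to $v_j$ is $g$. The gain of a path or circle is the sum of the gains of its edges, all oriented in the direction of traversal. A circle is a connected subgraph that is regular of degree 2, or its edge set (a loop is a circle of length 1). An edge set is balanced if every circle contained in it has gain $0$. A balanced edge set $B$ is closed if it contains every edge $g e_{ij}$ of $\Phi$ such that $B$ contains a path (possibly of length $0$) from $v_i$ to $v_j$ with gain $g$. $\operatorname{Lat}^{\mathrm b}\Phi$ is the set of all closed, balanced edge sets, ordered by inclusion. Convention: if $\Phi$ has a loop of gain $0$, so that $\varnothing$ is not closed, every $\mu(\varnothing,B)$ is read as $0$. For a balanced set $B$, $\pi(B)$ is the partition of $V$ into the vertex sets of the connected components of $(V,B)$. For $W\in\pi(B)$, the height $h_B(W)$ is the maximum gain of a path (in either direction, length $0$ with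 gain $0$ allowed) in the component of $(V,B)$ with vertex set $W$. For $m\in\mathbb Z$, $[m]=\{1,\dots,m\}$ (empty if $m\le 0$). An integral $m$-coloration is a function $x:V\to[m]$, $v_i\mapsto x_i$; it is proper if $x_j\ne x_i+g$ for every edge $g e_{ij}$ of $\Phi$. For real $r$, $r^+=\max(r,0)$. -}

module Defs where

open import Data.Bool.Base using (true; false; if_then_else_)
import Data.Bool.Properties as Bool
open import Data.Fin.Base using (Fin)
import Data.Fin.Properties as Fin
open import Data.Fin.Subset using (Subset; inside; outside; _∈_; _⊆_; _⊂_; ⊥)
open import Data.Fin.Subset.Induction using (⊂-wellFounded)
open import Data.Fin.Subset.Properties using (_∈?_; _⊆?_; _⊂?_)
open import Data.Integer.Base using (ℤ; +_; -[1+_]; 0ℤ; 1ℤ; _+_; _*_; _-_; -_; _⊔_)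
import Data.Integer.Properties as ℤ
open import Data.List.Base
  using (List; []; _∷_; [_]; map; foldr; filter; deduplicate; length; lookup; upTo; allFin;
         cartesianProduct; cartesianProductWith)
open import Data.List.Extrema ℤ.≤-totalOrder using (max)
import Data.List.Membership.Propositional as List
open import Data.List.Membership.Propositional.Properties
  using (∈-cartesianProductWith⁺; ∈-cartesianProduct⁺; ∈-allFin; ∈-lookup)
open import Data.List.Properties using (length-map)
open import Data.List.Relation.Unary.All as All using (All)
open import Data.List.Relation.Unary.Any as Any using (here; there)
open import Data.List.Relation.Unary.AllPairs as AllPairs using (_∷_)
open import Data.List.Relation.Unary.Unique.Propositional using (Unique)
import Data.List.Relation.Unary.Unique.DecPropositional as DecUnique
open import Data.Nat.Base as ℕ using (ℕ; zero; suc)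
open import Data.Product.Base using (∃-syntax; _×_; _,_; proj₁; proj₂)
open import Data.Sign.Base as Sign using (Sign; opposite)
open import Data.Vec.Base as Vec using (Vec; []; _∷_)
import Data.Vec.Properties as Vec
open import Induction.WellFounded using (WfRec; module All; module FixPoint)
open import Level using (0ℓ)
open import Relation.Binary.Definitions using (DecidableEquality)
open import Relation.Binary.PropositionalEquality
  using (_≡_; _≢_; refl; sym; trans; cong; cong₂; subst)
open import Relation.Nullary using (Dec; yes; no; does; contradiction)
open import Relation.Nullary.Decidable using (map′; _×-dec_; _→-dec_; ¬?)
open import Relation.Unary using (Pred; Decidable)

∑ ∏ : {A : Set} → List A → (A → ℤ) → ℤ
∑ xs f = foldr _+_ 0ℤ (map f xs)
∏ xs f = foldr _*_ 1ℤ (map f xs)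

_⁺ : ℤ → ℤ
r ⁺ = r ⊔ 0ℤ

[1⋯_] : ℤ → List ℤ
[1⋯ + k ]      = map (λ i → + suc i) (upTo k)
[1⋯ -[1+ _ ] ] = []

vectors : {A : Set} (n : ℕ) → List A → List (Vec A n)
vectors zero    xs = [ [] ]
vectors (suc n) xs = cartesianProductWith _∷_ xs (vectors n xs)

subsets : (n : ℕ) → List (Subset n)
subsets n = vectors n (outside ∷ inside ∷ [])

lists≤ : {A : Set} → ℕ → List A → List (List A)
lists≤ zero    xs = [ [] ]
lists≤ (suc k) xs = [] ∷ cartesianProductWith _∷_ xs (lists≤ k xs)

infix 4 _≟ˢ_
_≟ˢ_ : ∀ {n} → DecidableEquality (Subset n)
_≟ˢ_ = Vec.≡-dec Bool._≟_

infix 5 _⇒[_]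
_⇒[_] : {P : Set} → Dec P → (P → ℤ) → ℤ
yes p ⇒[ f ] = f p
no  _ ⇒[ f ] = 0ℤ

-- The Möbius function of the members of L ordered by inclusion, by recursion
-- on the upper argument:  μ(X,X) = 1  and  μ(X,Y) = - Σ_{X ⊆ Z ⊂ Y} μ(X,Z)
-- for X ≠ Y.  It is only meant for repetition-free L and X, Y in L.
module _ {n : ℕ} (L : List (Subset n)) (X : Subset n) where

  between? : ∀ Y → Decidable (λ Z → X ⊆ Z × Z ⊂ Y)
  between? Y Z = X ⊆? Z ×-dec Z ⊂? Y

  below : (Y : Subset n) → WfRec _⊂_ (λ _ → ℤ) Y → Subset n → ℤ
  below Y rec Z = between? Y Z ⇒[ (λ (_ , Z⊂Y) → rec Z⊂Y) ]

  möbius-step : (Y : Subset n) → WfRec _⊂_ (λ _ → ℤ) Y → ℤ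
  möbius-step Y rec = if does (X ≟ˢ Y) then 1ℤ else - ∑ L (below Y rec)

  möbius : Subset n → ℤ
  möbius = All.wfRec ⊂-wellFounded 0ℓ (λ _ → ℤ) möbius-step

  private
    ∑-cong : {f g : Subset n → ℤ} (Zs : List (Subset n)) →
                     (∀ Z → f Z ≡ g Z) → ∑ Zs f ≡ ∑ Zs g
    ∑-cong []       eq = refl
    ∑-cong (Z ∷ Zs) eq = cong₂ _+_ (eq Z) (∑-cong Zs eq)

    ⇒-cong : {P : Set} (d : Dec P) {f g : P → ℤ} → (∀ p → f p ≡ g p) → d ⇒[ f ] ≡ d ⇒[ g ]
    ⇒-cong (yes p) eq = eq p
    ⇒-cong (no  _) eq = refl

    ⇒-const : {P : Set} (d : Dec P) (c : ℤ) → d ⇒[ (λ _ → c) ] ≡ (if does d then c else 0ℤ)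
    ⇒-const (yes _) c = refl
    ⇒-const (no  _) c = refl

    step-ext : ∀ Y {IH IH′ : WfRec _⊂_ (λ _ → ℤ) Y} →
               (∀ {Z} (Z⊂Y : Z ⊂ Y) → IH Z⊂Y ≡ IH′ Z⊂Y) →
               möbius-step Y IH ≡ möbius-step Y IH′
    step-ext Y eq = cong (λ s → if does (X ≟ˢ Y) then 1ℤ else - s)
                         (∑-cong L (λ Z → ⇒-cong (between? Y Z) (λ (_ , Z⊂Y) → eq Z⊂Y)))

    ∑-filter : {P : Pred (Subset n) 0ℓ} (P? : Decidable P) (f : Subset n → ℤ) →
               ∀ Zs → ∑ Zs (λ Z → if does (P? Z) then f Z else 0ℤ) ≡ ∑ (filter P? Zs) f
    ∑-filter P? f []       = refl
    ∑-filter P? f (Z ∷ Zs) with does (P? Z)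
    ... | true  = cong (λ s → f Z + s) (∑-filter P? f Zs)
    ... | false = trans (ℤ.+-identityˡ _) (∑-filter P? f Zs)

  möbius-unfold : ∀ Y → möbius Y ≡
    (if does (X ≟ˢ Y) then 1ℤ
     else - ∑ (filter (between? Y) L) möbius)
  möbius-unfold Y = trans (FixPoint.unfold-wfRec ⊂-wellFounded (λ _ → ℤ) möbius-step step-ext)
    (cong (λ s → if does (X ≟ˢ Y) then 1ℤ else - s)
      (trans (∑-cong L (λ Z → ⇒-const (between? Y Z) (möbius Z)))
             (∑-filter (between? Y) möbius L)))

-- (e , +) is the edge e directed from the first to the second of its ends,
-- (e , -) is the same edge with the opposite orientation.
Oriented : ℕ → Set
Oriented n = Fin n × Sign

infix 9 _⁻¹
_⁻¹ : ∀ {n} → Oriented n → Oriented n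
(e , s) ⁻¹ = e , opposite s

record GainGraph : Set where
  field
    ∣V∣ ∣E∣ : ℕ
    ends    : Fin ∣E∣ → Fin ∣V∣ × Fin ∣V∣
    φ       : Oriented ∣E∣ → ℤ
    φ-⁻¹    : ∀ a → φ (a ⁻¹) ≡ - φ a

  V E : Set
  V = Fin ∣V∣
  E = Fin ∣E∣

  edge : Oriented ∣E∣ → E
  edge = proj₁

  tail head : Oriented ∣E∣ → V
  tail (e , Sign.+) = proj₁ (ends e)
  tail (e , Sign.-) = proj₂ (ends e)
  head a = tail (a ⁻¹)

module _ (Φ : GainGraph) where
  open GainGraph Φ

  private
    _∈ᴸ_ : {A : Set} → A → List A → Set
    x ∈ᴸ xs = x List.∈ xs

  gain : List (Oriented ∣E∣) → ℤ
  gain as = ∑ as φ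

  IsWalk : V → List (Oriented ∣E∣) → V → Set
  IsWalk u []       v = u ≡ v
  IsWalk u (a ∷ as) v = u ≡ tail a × IsWalk (head a) as v

  _UsesOnly_ : List (Oriented ∣E∣) → Subset ∣E∣ → Set
  as UsesOnly B = All (λ a → edge a ∈ B) as

  vertices : V → List (Oriented ∣E∣) → List V
  vertices u as = u ∷ map head as

  record IsPath (B : Subset ∣E∣) (u : V) (as : List (Oriented ∣E∣)) (v : V) : Set where
    constructor mkPath
    field
      isWalk   : IsWalk u as v
      distinct : Unique (vertices u as)
      inB      : as UsesOnly B

  -- A circle contained in B, traversed from one of its vertices.  Distinctness
  -- of the edges only matters in length 2, where it excludes going along an
  -- edge and straight back.
  record IsCircle (B : Subset ∣E∣) (u : V) (as : List (Oriented ∣E∣)) : Set where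
    constructor mkCircle
    field
      nonempty      : as ≢ []
      isWalk        : IsWalk u as u
      distinctVerts : Unique (map head as)
      distinctEdges : Unique (map edge as)
      inB           : as UsesOnly B

  Balanced : Pred (Subset ∣E∣) 0ℓ
  Balanced B = ∀ u as → IsCircle B u as → gain as ≡ 0ℤ

  Closed : Pred (Subset ∣E∣) 0ℓ
  Closed B = ∀ a as → IsPath B (tail a) as (head a) → gain as ≡ φ a → edge a ∈ B

  Connected : Subset ∣E∣ → V → V → Set
  Connected B u v = ∃[ as ] IsPath B u as v

  isWalk? : ∀ u as v → Dec (IsWalk u as v)
  isWalk? u []       v = u Fin.≟ v
  isWalk? u (a ∷ as) v = u Fin.≟ tail a ×-dec isWalk? (head a) as v

  usesOnly? : ∀ as B → Dec (as UsesOnly B)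
  usesOnly? as B = All.all? (λ a → edge a ∈? B) as

  isPath? : ∀ B u as v → Dec (IsPath B u as v)
  isPath? B u as v =
    map′ (λ (w , d , b) → mkPath w d b) (λ (mkPath w d b) → w , d , b)
      (isWalk? u as v ×-dec DecUnique.unique? Fin._≟_ (vertices u as) ×-dec usesOnly? as B)

  isCircle? : ∀ B u as → Dec (IsCircle B u as)
  isCircle? B u as =
    map′ (λ (n , w , d , e , b) → mkCircle n w d e b)
         (λ (mkCircle n w d e b) → n , w , d , e , b)
      (nonempty? as ×-dec isWalk? u as u ×-dec DecUnique.unique? Fin._≟_ (map head as)
        ×-dec DecUnique.unique? Fin._≟_ (map edge as) ×-dec usesOnly? as B)
    where
    nonempty? : (bs : List (Oriented ∣E∣)) → Dec (bs ≢ [])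
    nonempty? []      = no λ ne → ne refl
    nonempty? (_ ∷ _) = yes λ ()

  -- Paths and circles have at most ∣V∣ edges, so they all occur here.
  candidates : List (List (Oriented ∣E∣))
  candidates = lists≤ ∣V∣ (cartesianProduct (allFin ∣E∣) (Sign.+ ∷ Sign.- ∷ []))

  private
    ∈-lists≤ : {A : Set} {xs : List A} → (∀ x → x ∈ᴸ xs) →
               ∀ k ys → length ys ℕ.≤ k → ys ∈ᴸ lists≤ k xs
    ∈-lists≤ all zero    []       _         = here refl
    ∈-lists≤ all (suc k) []       _         = here refl
    ∈-lists≤ all (suc k) (y ∷ ys) (ℕ.s≤s p) =
      there (∈-cartesianProductWith⁺ _∷_ (all y) (∈-lists≤ all k ys p))

    lookup-injective : {A : Set} {xs : List A} → Unique xs →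
                       ∀ {i j} → lookup xs i ≡ lookup xs j → i ≡ j
    lookup-injective (_ ∷ u) {Fin.zero}  {Fin.zero}  eq = refl
    lookup-injective (p ∷ u) {Fin.zero}  {Fin.suc j} eq =
      contradiction eq (All.lookup p (∈-lookup j))
    lookup-injective (p ∷ u) {Fin.suc i} {Fin.zero}  eq =
      contradiction (sym eq) (All.lookup p (∈-lookup i))
    lookup-injective (_ ∷ u) {Fin.suc i} {Fin.suc j} eq = cong Fin.suc (lookup-injective u eq)

    heads⇒candidate : ∀ as → Unique (map head as) → as ∈ᴸ candidates
    heads⇒candidate as u = ∈-lists≤ ∈-oriented ∣V∣ as
      (subst (ℕ._≤ ∣V∣) (length-map head as) (Fin.injective⇒≤ (lookup-injective u)))
      where
      ∈-sign : ∀ s → s ∈ᴸ (Sign.+ ∷ Sign.- ∷ [])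
      ∈-sign Sign.+ = here refl
      ∈-sign Sign.- = there (here refl)

      ∈-oriented : ∀ a → a ∈ᴸ cartesianProduct (allFin ∣E∣) (Sign.+ ∷ Sign.- ∷ [])
      ∈-oriented (e , s) = ∈-cartesianProduct⁺ (∈-allFin e) (∈-sign s)

  circle⇒candidate : ∀ {B u as} → IsCircle B u as → as ∈ᴸ candidates
  circle⇒candidate c = heads⇒candidate _ (IsCircle.distinctVerts c)

  path⇒candidate : ∀ {B u as v} → IsPath B u as v → as ∈ᴸ candidates
  path⇒candidate p = heads⇒candidate _ (AllPairs.tail (IsPath.distinct p))

  balanced? : Decidable Balanced
  balanced? B =
    map′ (λ h u as c → All.lookup (h u) (circle⇒candidate c) c)
         (λ h u → All.tabulate λ {as} _ → h u as)
      (Fin.all? λ u → All.all? (λ as → isCircle? B u as →-dec gain as ℤ.≟ 0ℤ) candidates)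

  closed? : Decidable Closed
  closed? B =
    map′ (λ h (e , s) as p → All.lookup (pick s (h e)) (path⇒candidate p) p)
         (λ h e → All.tabulate (λ {as} _ → h (e , Sign.+) as)
                , All.tabulate (λ {as} _ → h (e , Sign.-) as))
      (Fin.all? λ e → closedAt? (e , Sign.+) ×-dec closedAt? (e , Sign.-))
    where
    ClosedAt : Oriented ∣E∣ → Pred (List (Oriented ∣E∣)) 0ℓ
    ClosedAt a as = IsPath B (tail a) as (head a) → gain as ≡ φ a → edge a ∈ B

    closedAt? : ∀ a → Dec (All (ClosedAt a) candidates)
    closedAt? a = All.all? (λ as → isPath? B (tail a) as (head a) →-dec
                                   (gain as ℤ.≟ φ a →-dec edge a ∈? B)) candidates

    pick : ∀ {e} s → All (ClosedAt (e , Sign.+)) candidates × All (ClosedAt (e , Sign.-)) candidates →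
           All (ClosedAt (e , s)) candidates
    pick Sign.+ = proj₁
    pick Sign.- = proj₂

  connected? : ∀ B u v → Dec (Connected B u v)
  connected? B u v =
    map′ (λ h → Any.satisfied h) (λ (as , p) → List.lose (path⇒candidate p) p)
      (Any.any? (λ as → isPath? B u as v) candidates)

  Latᵇ : List (Subset ∣E∣)
  Latᵇ = filter (λ B → balanced? B ×-dec closed? B) (subsets ∣E∣)

  -- μ(∅,B) in Latᵇ, read as 0 when ∅ is not closed (∅ is always balanced).
  μ∅ : Subset ∣E∣ → ℤ
  μ∅ B = if does (closed? ⊥) then möbius Latᵇ ⊥ B else 0ℤ

  component : Subset ∣E∣ → V → Subset ∣V∣
  component B u = Vec.tabulate (λ v → does (connected? B u v))

  π : Subset ∣E∣ → List (Subset ∣V∣)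
  π B = deduplicate _≟ˢ_ (map (component B) (allFin ∣V∣))

  -- For W in π B these are exactly the paths, in either direction, of the
  -- component of (V,B) with vertex set W.
  PathIn : Subset ∣E∣ → Subset ∣V∣ → Pred (V × List (Oriented ∣E∣)) 0ℓ
  PathIn B W (u , as) = All (_∈ W) (vertices u as) × ∃[ v ] IsPath B u as v

  pathIn? : ∀ B W → Decidable (PathIn B W)
  pathIn? B W (u , as) =
    All.all? (_∈? W) (vertices u as) ×-dec Fin.any? (λ v → isPath? B u as v)

  -- The default value 0 given to max is itself the gain of a path of length 0.
  height : Subset ∣E∣ → Subset ∣V∣ → ℤ
  height B W = max 0ℤ (map (λ (u , as) → gain as)
    (filter (pathIn? B W) (cartesianProduct (allFin ∣V∣) candidates)))

  Proper : Pred (Vec ℤ ∣V∣) 0ℓ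
  Proper x = ∀ a → Vec.lookup x (head a) ≢ Vec.lookup x (tail a) + φ a

  proper? : Decidable Proper
  proper? x =
    map′ (λ { h (e , Sign.+) → proj₁ (h e) ; h (e , Sign.-) → proj₂ (h e) })
         (λ h e → h (e , Sign.+) , h (e , Sign.-))
      (Fin.all? λ e → properAt? (e , Sign.+) ×-dec properAt? (e , Sign.-))
    where
    properAt? : ∀ a → Dec (Vec.lookup x (head a) ≢ Vec.lookup x (tail a) + φ a)
    properAt? a = ¬? (Vec.lookup x (head a) ℤ.≟ Vec.lookup x (tail a) + φ a)

  χᶻ : ℤ → ℕ
  χᶻ m = length (filter proper? (vectors ∣V∣ [1⋯ m ]))

{-# OPTIONS --safe #-}

-- The improper edges of a coloring x form a closed balanced set I(x), and x is proper iff
-- I(x) = ∅.  The defining recursion of μ turns the indicator of I(x) = ∅ into the sum of μ(∅,B)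
-- over B ⊆ I(x), so the formula follows by exchanging sums once the x with B ⊆ I(x) are counted.
-- Along the edges of B such an x changes by the gains, and B being balanced makes the gain
-- between two vertices of a block path-independent.  If ∅ is not closed, it is no I(x), so there
-- is no proper coloring.
module Submission where

open import Defs
open import Data.Bool.Base using (true; false; if_then_else_)
open import Data.Fin.Base using (Fin; zero; suc)
import Data.Fin.Properties as Fin
open import Data.Fin.Subset using (Subset; inside; outside; _⊆_; ⊥) renaming (_∈_ to _∈ˢ_)
open import Data.Fin.Subset.Properties
  using (_∈?_; _⊆?_; _⊂?_; ⊆-refl; ⊆-antisym; ⊥⊆; ∉⊥; Empty-unique)
open import Data.Integer.Base using (ℤ; +_; -[1+_]; 0ℤ; 1ℤ; _+_; _*_; _-_; -_; _≤_; +≤+)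
import Data.Integer.Properties as ℤ
import Data.Integer.Tactic.RingSolver as ℤSolver
open import Data.List.Base
  using (List; []; _∷_; _++_; map; filter; foldr; length; lookup; upTo; allFin;
         cartesianProduct; cartesianProductWith)
open import Data.List.Extrema ℤ.≤-totalOrder using (argmax-sel; xs≤max)
open import Data.List.Membership.Propositional using (_∈_)
open import Data.List.Membership.Propositional.Properties
  using (∈-map⁺; ∈-map⁻; ∈-∃++; ∈-lookup; ∈-allFin; ∈-upTo⁺; ∈-upTo⁻;
         ∈-filter⁺; ∈-filter⁻; ∈-deduplicate⁺; ∈-deduplicate⁻; ∈-cartesianProduct⁺;
         ∈-cartesianProductWith⁺; ∈-cartesianProductWith⁻)
open import Data.List.Membership.Propositional.Properties.WithK using (unique∧set⇒bag)
open import Data.List.Properties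
  using (length-map; length-++; length-upTo; map-cong; filter-none; filter-≐)
open import Data.List.Relation.Binary.BagAndSetEquality using (∼bag⇒↭)
open import Data.List.Relation.Binary.Permutation.Propositional using (_↭_; refl; prep; swap; trans)
open import Data.List.Relation.Binary.Permutation.Propositional.Properties using (↭-length)
open import Data.List.Relation.Unary.All as All using (All)
open import Data.List.Relation.Unary.All.Properties using (¬Any⇒All¬)
open import Data.List.Relation.Unary.AllPairs using ([]; _∷_)
open import Data.List.Relation.Unary.Any as Any using (here; there; any?)
open import Data.List.Relation.Unary.Any.Properties using (lookup-index)
open import Data.List.Relation.Unary.Unique.DecPropositional.Properties using (deduplicate-!)
open import Data.List.Relation.Unary.Unique.Propositional using (Unique)
import Data.List.Relation.Unary.Unique.Propositional.Properties as Unique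
open import Data.Nat.Base as ℕ using (ℕ; zero; suc)
open import Data.Nat.Induction using (Acc; acc; <-wellFounded)
import Data.Nat.Properties as ℕ
import Data.Nat.Tactic.RingSolver as ℕSolver
open import Data.Product.Base using (∃-syntax; _×_; _,_; proj₁; proj₂)
import Data.Sign.Base as Sign
open import Data.Sum.Base using (_⊎_; inj₁; inj₂)
open import Data.Vec.Base as Vec using (Vec; []; _∷_)
import Data.Vec.Properties as Vec
open import Function.Base using (_∘_; id)
open import Function.Bundles using (mk⇔)
open import Level using (0ℓ)
open import Relation.Binary.Definitions using (DecidableEquality)
open import Relation.Binary.PropositionalEquality as ≡
  using (_≡_; _≢_; refl; sym; cong; cong₂; subst; module ≡-Reasoning)
open import Relation.Nullary using (Dec; yes; no; ¬_; does; contradiction)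
open import Relation.Nullary.Decidable using (_×-dec_; dec-true; dec-false; does-⇔)
open import Relation.Unary using (Pred; Decidable)

open ≡-Reasoning

-- Balance speaks of circles only, but comparing gains inside a block needs concatenations and
-- reversals of paths, and these are merely walks. Hence the induction on length that carries gain 0
-- from circles to all closed walks; the count for a fixed B rests on it. That count picks one start
-- value per block, independently of the other blocks, and this is the origin of the product over
-- blocks: the colorings concerned are the injective image of a list of choices. Since all lists
-- involved are free of repetitions, equal membership already yields a permutation, hence equal
-- length. The recursion of μ is used with I(x) as its upper argument, which is why I(x) has to be a
-- member of the lattice.

private
  variable
    A C : Set
    P : A → Set
    xs ys : List A
    f g : A → ℤ

-- Sums over lists and indicators.

↭-fromUnique : Unique xs → Unique ys → (∀ {z} → z ∈ xs → z ∈ ys) → (∀ {z} → z ∈ ys → z ∈ xs) →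
               xs ↭ ys
↭-fromUnique xs! ys! to from = ∼bag⇒↭ (unique∧set⇒bag xs! ys! (mk⇔ to from))

i≡i+j-j : ∀ i j → i ≡ i + j - j
i≡i+j-j = ℤSolver.solve-∀

∑-cong : (∀ {x} → x ∈ xs → f x ≡ g x) → ∑ xs f ≡ ∑ xs g
∑-cong {xs = []}     eq = refl
∑-cong {xs = x ∷ xs} eq = cong₂ _+_ (eq (here refl)) (∑-cong (eq ∘ there))

∑-++ : ∀ (xs ys : List A) f → ∑ (xs ++ ys) f ≡ ∑ xs f + ∑ ys f
∑-++ []       ys f = sym (ℤ.+-identityˡ _)
∑-++ (x ∷ xs) ys f =
  ≡.trans (cong (λ s → f x + s) (∑-++ xs ys f)) (sym (ℤ.+-assoc (f x) (∑ xs f) (∑ ys f)))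

∑-zero : ∀ (xs : List A) → ∑ xs (λ _ → 0ℤ) ≡ 0ℤ
∑-zero []       = refl
∑-zero (x ∷ xs) = ≡.trans (ℤ.+-identityˡ _) (∑-zero xs)

∑-+ : ∀ (xs : List A) f g → ∑ xs (λ x → f x + g x) ≡ ∑ xs f + ∑ xs g
∑-+ []       f g = refl
∑-+ (x ∷ xs) f g =
  ≡.trans (cong (λ s → f x + g x + s) (∑-+ xs f g)) (interchange (f x) (g x) (∑ xs f) (∑ xs g))
  where open import Algebra.Properties.CommutativeSemigroup ℤ.+-commutativeSemigroup

∑-*ˡ : ∀ (xs : List A) c f → ∑ xs (λ x → c * f x) ≡ c * ∑ xs f
∑-*ˡ []       c f = sym (ℤ.*-zeroʳ c)
∑-*ˡ (x ∷ xs) c f =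
  ≡.trans (cong (λ s → c * f x + s) (∑-*ˡ xs c f)) (sym (ℤ.*-distribˡ-+ c (f x) (∑ xs f)))

∑-comm : ∀ (xs : List A) (ys : List C) (h : A → C → ℤ) →
         ∑ xs (λ x → ∑ ys (h x)) ≡ ∑ ys (λ y → ∑ xs (λ x → h x y))
∑-comm []       ys h = sym (∑-zero ys)
∑-comm (x ∷ xs) ys h =
  ≡.trans (cong (λ s → ∑ ys (h x) + s) (∑-comm xs ys h))
          (sym (∑-+ ys (h x) (λ y → ∑ xs (λ x → h x y))))

∑-↭ : xs ↭ ys → ∀ f → ∑ xs f ≡ ∑ ys f
∑-↭ refl                 f = refl
∑-↭ (prep x p)           f = cong (λ s → f x + s) (∑-↭ p f)
∑-↭ (swap {ys = ys} x y p) f =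
  ≡.trans (cong (λ s → f x + (f y + s)) (∑-↭ p f)) (x∙yz≈y∙xz (f x) (f y) (∑ ys f))
  where open import Algebra.Properties.CommutativeSemigroup ℤ.+-commutativeSemigroup
∑-↭ (trans p q)          f = ≡.trans (∑-↭ p f) (∑-↭ q f)

𝟙 : Dec A → ℤ
𝟙 d = if does d then 1ℤ else 0ℤ

𝟙-cong : (A → C) → (C → A) → (a? : Dec A) (c? : Dec C) → 𝟙 a? ≡ 𝟙 c?
𝟙-cong to from a? c? = cong (if_then 1ℤ else 0ℤ) (does-⇔ (mk⇔ to from) a? c?)

length-filter : (P? : Decidable P) → ∀ xs → + length (filter P? xs) ≡ ∑ xs (𝟙 ∘ P?)
length-filter P? []       = refl
length-filter P? (x ∷ xs) with does (P? x)
... | true  = cong₂ _+_ (refl {x = 1ℤ}) (length-filter P? xs)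
... | false = ≡.trans (length-filter P? xs) (sym (ℤ.+-identityˡ _))

∑-filter : (P? : Decidable P) → ∀ xs → ∑ (filter P? xs) f ≡ ∑ xs (λ x → f x * 𝟙 (P? x))
∑-filter P? []       = refl
∑-filter {f = f} P? (x ∷ xs) with does (P? x)
... | true  = cong₂ _+_ (sym (ℤ.*-identityʳ (f x))) (∑-filter P? xs)
... | false = ≡.trans (∑-filter P? xs)
  (sym (≡.trans (cong (_+ _) (ℤ.*-zeroʳ (f x))) (ℤ.+-identityˡ _)))

-- Integer intervals and lists of choices.

∈-[1⋯]⁻ : ∀ k {x} → x ∈ [1⋯ k ] → 1ℤ ≤ x × x ≤ k
∈-[1⋯]⁻ (+ k) x∈ with i , i∈ , refl ← ∈-map⁻ _ x∈ = +≤+ (ℕ.s≤s ℕ.z≤n) , +≤+ (∈-upTo⁻ i∈)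

∈-[1⋯]⁺ : ∀ k {x} → 1ℤ ≤ x → x ≤ k → x ∈ [1⋯ k ]
∈-[1⋯]⁺ (+ k) {+ suc x} (+≤+ _) (+≤+ x≤k) = ∈-map⁺ _ (∈-upTo⁺ x≤k)
∈-[1⋯]⁺ k {+ zero} (+≤+ ()) _

[1⋯]-unique : ∀ k → Unique [1⋯ k ]
[1⋯]-unique (+ k)      = Unique.map⁺ (λ { refl → refl }) (Unique.upTo⁺ k)
[1⋯]-unique -[1+ _ ] = []

-- Origin of the positive part in the formula: for k = m - h_B(W) below 0 no start value exists.
length-[1⋯] : ∀ k → + length [1⋯ k ] ≡ k ⁺
length-[1⋯] (+ k)      =
  cong +_ (≡.trans (length-map _ (upTo k)) (≡.trans (length-upTo k) (sym (ℕ.⊔-identityʳ k))))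
length-[1⋯] -[1+ _ ] = refl

-- Dependent analogue of `vectors`, with a list for each position: the start values of different
-- blocks come from intervals whose lengths depend on the heights.
choices : ∀ {n} → (Fin n → List A) → List (Vec A n)
choices {n = zero}  r = [] ∷ []
choices {n = suc n} r = cartesianProductWith _∷_ (r zero) (choices (r ∘ suc))

vectors≡choices : ∀ n (xs : List A) → vectors n xs ≡ choices {n = n} (λ _ → xs)
vectors≡choices zero    xs = refl
vectors≡choices (suc n) xs = cong (cartesianProductWith _∷_ xs) (vectors≡choices n xs)

∈-choices⁺ : ∀ {n} {r : Fin n → List A} c → (∀ i → Vec.lookup c i ∈ r i) → c ∈ choices r
∈-choices⁺ []      c∈ = here refl
∈-choices⁺ (x ∷ c) c∈ = ∈-cartesianProductWith⁺ _∷_ (c∈ zero) (∈-choices⁺ c (c∈ ∘ suc))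

∈-choices⁻ : ∀ {n} {r : Fin n → List A} {c} → c ∈ choices r → ∀ i → Vec.lookup c i ∈ r i
∈-choices⁻ {n = suc n} {r} c∈ i
  with x , d , x∈ , d∈ , refl ← ∈-cartesianProductWith⁻ _∷_ (r zero) _ c∈ with i
... | zero  = x∈
... | suc i = ∈-choices⁻ d∈ i

choices-unique : ∀ {n} {r : Fin n → List A} → (∀ i → Unique (r i)) → Unique (choices r)
choices-unique {n = zero}  r! = All.[] ∷ []
choices-unique {n = suc n} r! =
  Unique.cartesianProductWith⁺ _∷_ Vec.∷-injective (r! zero) (choices-unique (r! ∘ suc))

length-cartesianProductWith : ∀ {D : Set} (h : A → C → D) xs ys →
                              length (cartesianProductWith h xs ys) ≡ length xs ℕ.* length ys
length-cartesianProductWith h []       ys = refl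
length-cartesianProductWith h (x ∷ xs) ys =
  ≡.trans (length-++ (map (h x) ys))
    (cong₂ ℕ._+_ (length-map (h x) ys) (length-cartesianProductWith h xs ys))

length-choices : ∀ xs (r : A → List C) →
                 + length (choices (r ∘ lookup xs)) ≡ ∏ xs (λ x → + length (r x))
length-choices []       r = refl
length-choices (x ∷ xs) r = begin
  + length (choices (r ∘ lookup (x ∷ xs)))
    ≡⟨ cong +_ (length-cartesianProductWith _∷_ (r x) _) ⟩
  + (length (r x) ℕ.* length (choices (r ∘ lookup xs)))
    ≡⟨ ℤ.pos-* (length (r x)) _ ⟩
  + length (r x) * + length (choices (r ∘ lookup xs))
    ≡⟨ cong (+ length (r x) *_) (length-choices xs r) ⟩
  ∏ (x ∷ xs) (λ x → + length (r x)) ∎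

∈-vectors⁺ : ∀ {n} {xs : List A} x → (∀ i → Vec.lookup x i ∈ xs) → x ∈ vectors n xs
∈-vectors⁺ {n = n} {xs} x x∈ = subst (x ∈_) (sym (vectors≡choices n xs)) (∈-choices⁺ x x∈)

∈-vectors⁻ : ∀ {n} {xs : List A} {x} → x ∈ vectors n xs → ∀ i → Vec.lookup x i ∈ xs
∈-vectors⁻ {n = n} {xs} x∈ = ∈-choices⁻ (subst (_ ∈_) (vectors≡choices n xs) x∈)

vectors-unique : ∀ n → Unique xs → Unique (vectors n xs)
vectors-unique {xs = xs} n xs! =
  subst Unique (sym (vectors≡choices n xs)) (choices-unique (λ _ → xs!))

subsets-unique : ∀ n → Unique (subsets n)
subsets-unique n = vectors-unique n (((λ ()) All.∷ All.[]) ∷ All.[] ∷ [])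

∈-subsets : ∀ {n} (S : Subset n) → S ∈ subsets n
∈-subsets S = ∈-vectors⁺ S λ i → ∈-bits (Vec.lookup S i)
  where
  ∈-bits : ∀ b → b ∈ outside ∷ inside ∷ []
  ∈-bits false = here refl
  ∈-bits true  = there (here refl)

-- Möbius inversion.

interval? : ∀ {n} (X Y : Subset n) → Decidable (λ Z → X ⊆ Z × Z ⊆ Y)
interval? X Y Z = X ⊆? Z ×-dec Z ⊆? Y

module _ {n} {L : List (Subset n)} (L! : Unique L) (X : Subset n) where

  -- Bridges the recursion, which sums over Z strictly below Y, and the inversion, which also needs
  -- Z = Y.
  interval-↭ : ∀ {Y} → Y ∈ L → X ⊆ Y → filter (interval? X Y) L ↭ Y ∷ filter (between? L X Y) L
  interval-↭ {Y} Y∈ X⊆Y = ↭-fromUnique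
    (Unique.filter⁺ (interval? X Y) L!)
    (All.tabulate (λ Z∈ Y≡Z → Y≢ Z∈ Y≡Z) ∷ Unique.filter⁺ (between? L X Y) L!)
    to from
    where
    Y≢ : ∀ {Z} → Z ∈ filter (between? L X Y) L → Y ≢ Z
    Y≢ Z∈ refl with _ , _ , _ , _ , y∈ , y∉ ← ∈-filter⁻ (between? L X Y) {xs = L} Z∈ = y∉ y∈

    to : ∀ {Z} → Z ∈ filter (interval? X Y) L → Z ∈ Y ∷ filter (between? L X Y) L
    to {Z} Z∈ with ∈-filter⁻ (interval? X Y) {xs = L} Z∈ | Z ⊂? Y
    ... | Z∈L , X⊆Z , Z⊆Y | yes Z⊂Y = there (∈-filter⁺ (between? L X Y) Z∈L (X⊆Z , Z⊂Y))
    ... | Z∈L , X⊆Z , Z⊆Y | no  Z⊄Y = here (⊆-antisym Z⊆Y Y⊆Z)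
      where
      Y⊆Z : Y ⊆ Z
      Y⊆Z {i} i∈Y with i ∈? Z
      ... | yes i∈Z = i∈Z
      ... | no  i∉Z = contradiction ((λ {j} → Z⊆Y {j}) , i , i∈Y , i∉Z) Z⊄Y

    from : ∀ {Z} → Z ∈ Y ∷ filter (between? L X Y) L → Z ∈ filter (interval? X Y) L
    from (here refl) = ∈-filter⁺ (interval? X Y) Y∈ (X⊆Y , ⊆-refl)
    from (there Z∈) with Z∈L , X⊆Z , Z⊆Y , _ ← ∈-filter⁻ (between? L X Y) {xs = L} Z∈ =
      ∈-filter⁺ (interval? X Y) Z∈L (X⊆Z , Z⊆Y)

  -- The recursion makes the value at Y minus the sum strictly below Y, so together they cancel; for
  -- Y = X nothing lies strictly below and the value 1 remains. If X is outside L, then Y differs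
  -- from X and the total is 0, as the right side says.
  ∑-möbius : ∀ {Y} → Y ∈ L → X ⊆ Y → ∑ (filter (interval? X Y) L) (möbius L X) ≡ 𝟙 (X ≟ˢ Y)
  ∑-möbius {Y} Y∈ X⊆Y = ≡.trans (∑-↭ (interval-↭ Y∈ X⊆Y) (möbius L X)) lemma
    where
    open-interval : List (Subset n)
    open-interval = filter (between? L X Y) L

    lemma : möbius L X Y + ∑ open-interval (möbius L X) ≡ 𝟙 (X ≟ˢ Y)
    lemma rewrite möbius-unfold L X Y with X ≟ˢ Y
    ... | no  _    = ℤ.+-inverseˡ (∑ open-interval (möbius L X))
    ... | yes refl = cong (λ Zs → 1ℤ + ∑ Zs (möbius L X)) (filter-none (between? L X X) {xs = L}
      (All.tabulate λ { {Z} _ (X⊆Z , _ , i , i∈X , i∉Z) → i∉Z (X⊆Z i∈X) }))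

-- Subsets given by predicates, repetitions in lists.

lookup-injective : Unique xs → ∀ {i j} → lookup xs i ≡ lookup xs j → i ≡ j
lookup-injective (_  ∷ xs!) {zero}  {zero}  eq = refl
lookup-injective (x∉ ∷ xs!) {zero}  {suc j} eq = contradiction eq (All.lookup x∉ (∈-lookup j))
lookup-injective (x∉ ∷ xs!) {suc i} {zero}  eq =
  contradiction (sym eq) (All.lookup x∉ (∈-lookup i))
lookup-injective (_  ∷ xs!) {suc i} {suc j} eq = cong suc (lookup-injective xs! eq)

∈-tabulate⁺ : ∀ {n} {P : Pred (Fin n) 0ℓ} (P? : Decidable P) {i} →
              P i → i ∈ˢ Vec.tabulate (does ∘ P?)
∈-tabulate⁺ P? {i} p = Vec.lookup⇒[]= i _ (≡.trans (Vec.lookup∘tabulate _ i) (dec-true (P? i) p))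

∈-tabulate⁻ : ∀ {n} {P : Pred (Fin n) 0ℓ} (P? : Decidable P) {i} →
              i ∈ˢ Vec.tabulate (does ∘ P?) → P i
∈-tabulate⁻ P? {i} i∈
  with P? i | ≡.trans (sym (Vec.lookup∘tabulate (does ∘ P?) i)) (Vec.[]=⇒lookup i∈)
... | yes p | _ = p

-- Indexed by the list in split form: matching on `repeat` replaces a closed walk by the pieces at
-- which it is to be cut.
data Repeat (h : A → C) : List A → Set where
  repeat : ∀ xs x ys y zs → h x ≡ h y → Repeat h (xs ++ x ∷ ys ++ y ∷ zs)

unique⊎repeat : DecidableEquality C → (h : A → C) → ∀ xs → Unique (map h xs) ⊎ Repeat h xs
unique⊎repeat _≟_ h []       = inj₁ []
unique⊎repeat _≟_ h (x ∷ xs) with any? (h x ≟_) (map h xs)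
... | yes hx∈ with y , y∈ , hx≡hy ← ∈-map⁻ h hx∈ with ys , zs , refl ← ∈-∃++ y∈ =
  inj₂ (repeat [] x ys y zs hx≡hy)
... | no  hx∉ with unique⊎repeat _≟_ h xs
...   | inj₁ hxs!                     = inj₁ (¬Any⇒All¬ _ hx∉ ∷ hxs!)
...   | inj₂ (repeat ws y ys z zs eq) = inj₂ (repeat (x ∷ ws) y ys z zs eq)

-- With the excess (less one) given explicitly, a comparison of lengths becomes an identity for the
-- ring solver.
<-fromExcess : ∀ {m n} k → n ≡ suc m ℕ.+ k → m ℕ.< n
<-fromExcess k refl = ℕ.m≤m+n _ k

length-repeat : ∀ (xs : List A) x ys y zs →
  length (xs ++ x ∷ ys ++ y ∷ zs) ≡ length xs ℕ.+ suc (length ys ℕ.+ suc (length zs))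
length-repeat xs x ys y zs =
  ≡.trans (length-++ xs) (cong (λ k → length xs ℕ.+ suc k) (length-++ ys))

-- Walks and their gains.

module _ (Φ : GainGraph) where
  open GainGraph Φ

  private
    variable
      B : Subset ∣E∣
      u v w : V
      as bs : List (Oriented ∣E∣)

  -- Unlike paths, walks can be concatenated and reversed freely, so gains are compared on walks;
  -- `walk⇒connected` leads back to paths.
  Walk : Subset ∣E∣ → V → List (Oriented ∣E∣) → V → Set
  Walk B u as v = IsWalk Φ u as v × _UsesOnly_ Φ as B

  path⇒walk : IsPath Φ B u as v → Walk B u as v
  path⇒walk (mkPath p _ as∈) = p , as∈

  edge-walk : ∀ a → edge a ∈ˢ B → Walk B (tail a) (a ∷ []) (head a)
  edge-walk a a∈ = (refl , refl) , a∈ All.∷ All.[]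

  walk-++⁺ : ∀ as → Walk B u as w → Walk B w bs v → Walk B u (as ++ bs) v
  walk-++⁺ []       (refl , _) q = q
  walk-++⁺ (a ∷ as) ((eq , p) , a∈ All.∷ as∈) q with r , rs∈ ← walk-++⁺ as (p , as∈) q =
    (eq , r) , a∈ All.∷ rs∈

  walk-++⁻ : ∀ as → Walk B u (as ++ bs) v → ∃[ w ] Walk B u as w × Walk B w bs v
  walk-++⁻ []       p = _ , (refl , All.[]) , p
  walk-++⁻ (a ∷ as) ((eq , p) , a∈ All.∷ as∈)
    with w , (q , qs∈) , r ← walk-++⁻ as (p , as∈) = w , ((eq , q) , a∈ All.∷ qs∈) , r

  head-⁻¹ : ∀ a → head (a ⁻¹) ≡ tail a
  head-⁻¹ (e , Sign.+) = refl
  head-⁻¹ (e , Sign.-) = refl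

  walk-reverse : ∀ as → Walk B u as v → ∃[ bs ] Walk B v bs u × gain Φ bs ≡ - gain Φ as
  walk-reverse []       (refl , _) = [] , (refl , All.[]) , refl
  walk-reverse (a ∷ as) ((refl , p) , a∈ All.∷ as∈) with bs , q , eq ← walk-reverse as (p , as∈) =
    bs ++ a ⁻¹ ∷ [] , walk-++⁺ bs q ((refl , head-⁻¹ a) , a∈ All.∷ All.[]) , (begin
      gain Φ (bs ++ a ⁻¹ ∷ [])       ≡⟨ ∑-++ bs (a ⁻¹ ∷ []) φ ⟩
      gain Φ bs + (φ (a ⁻¹) + 0ℤ)   ≡⟨ cong₂ (λ g h → g + (h + 0ℤ)) eq (φ-⁻¹ a) ⟩
      - gain Φ as + (- φ a + 0ℤ)    ≡⟨ negate (gain Φ as) (φ a) ⟩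
      - (φ a + gain Φ as)           ∎)
    where
    negate : ∀ g h → - g + (- h + 0ℤ) ≡ - (h + g)
    negate = ℤSolver.solve-∀

  -- Closed walks in balanced sets.

  same-or-opposite : ∀ a b → edge a ≡ edge b → a ≡ b ⊎ b ≡ a ⁻¹
  same-or-opposite (e , Sign.+) (_ , Sign.+) refl = inj₁ refl
  same-or-opposite (e , Sign.+) (_ , Sign.-) refl = inj₂ refl
  same-or-opposite (e , Sign.-) (_ , Sign.+) refl = inj₂ refl
  same-or-opposite (e , Sign.-) (_ , Sign.-) refl = inj₁ refl

  gain-repeat : ∀ as a bs b cs →
    gain Φ (as ++ a ∷ bs ++ b ∷ cs) ≡ gain Φ as + (φ a + (gain Φ bs + (φ b + gain Φ cs)))
  gain-repeat as a bs b cs = ≡.trans (∑-++ as (a ∷ bs ++ b ∷ cs) φ)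
    (cong (λ g → gain Φ as + (φ a + g)) (∑-++ bs (b ∷ cs) φ))

  walk-repeat⁻ : ∀ as a bs b cs → Walk B u (as ++ a ∷ bs ++ b ∷ cs) v →
    Walk B u as (tail a) × edge a ∈ˢ B × Walk B (head a) bs (tail b) × edge b ∈ˢ B ×
    Walk B (head b) cs v
  walk-repeat⁻ as a bs b cs p
    with _ , p₁ , (refl , q) , a∈ All.∷ q∈ ← walk-++⁻ as p
    with _ , p₂ , (refl , r) , b∈ All.∷ r∈ ← walk-++⁻ bs (q , q∈) = p₁ , a∈ , p₂ , b∈ , r , r∈

  -- The induction hypothesis of `gain-closedWalk`, isolated so that each decomposition is a lemma
  -- of its own. The base vertex `w` varies because the inner part of a decomposed walk starts
  -- elsewhere.
  ShorterClosed₀ : Subset ∣E∣ → ℕ → Set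
  ShorterClosed₀ B n = ∀ {w} ds → length ds ℕ.< n → Walk B w ds w → gain Φ ds ≡ 0ℤ

  -- Cut at the two visits to `head a`: `bs ++ b ∷ []` is closed at that vertex, and `as ++ a ∷ cs`
  -- is closed at `u`. Each is shorter, as it omits one of the two marked edges.
  gain-repeatedHead : ∀ as a bs b cs → head a ≡ head b →
    ShorterClosed₀ B (length (as ++ a ∷ bs ++ b ∷ cs)) →
    Walk B u (as ++ a ∷ bs ++ b ∷ cs) u → gain Φ (as ++ a ∷ bs ++ b ∷ cs) ≡ 0ℤ
  gain-repeatedHead {B} {u} as a bs b cs eq shorter p
    with p₁ , a∈ , p₂ , b∈ , p₃ ← walk-repeat⁻ as a bs b cs p = begin
      gain Φ (as ++ a ∷ bs ++ b ∷ cs)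
        ≡⟨ gain-repeat as a bs b cs ⟩
      gain Φ as + (φ a + (gain Φ bs + (φ b + gain Φ cs)))
        ≡⟨ rearrange (gain Φ as) (φ a) (gain Φ bs) (φ b) (gain Φ cs) ⟩
      (gain Φ as + (φ a + gain Φ cs)) + (gain Φ bs + (φ b + 0ℤ))
        ≡⟨ cong₂ _+_ (∑-++ as (a ∷ cs) φ) (∑-++ bs (b ∷ []) φ) ⟨
      gain Φ (as ++ a ∷ cs) + gain Φ (bs ++ b ∷ [])
        ≡⟨ cong₂ _+_ (shorter (as ++ a ∷ cs) outer< outer) (shorter (bs ++ b ∷ []) inner< inner) ⟩
      0ℤ ∎
    where
    rearrange : ∀ r s t v w → r + (s + (t + (v + w))) ≡ (r + (s + w)) + (t + (v + 0ℤ))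
    rearrange = ℤSolver.solve-∀

    outer : Walk B u (as ++ a ∷ cs) u
    outer = walk-++⁺ as p₁ (walk-++⁺ (a ∷ []) (edge-walk a a∈)
      (subst (λ w → Walk B w cs u) (sym eq) p₃))

    inner : Walk B (head a) (bs ++ b ∷ []) (head a)
    inner = walk-++⁺ bs p₂ (subst (Walk B (tail b) (b ∷ [])) (sym eq) (edge-walk b b∈))

    outer< : length (as ++ a ∷ cs) ℕ.< length (as ++ a ∷ bs ++ b ∷ cs)
    outer< = <-fromExcess (length bs) (≡.trans (length-repeat as a bs b cs)
      (≡.trans (lengths (length as) (length bs) (length cs))
        (cong (λ k → suc k ℕ.+ length bs) (sym (length-++ as)))))
      where
      lengths : ∀ i j k → i ℕ.+ suc (j ℕ.+ suc k) ≡ suc (i ℕ.+ suc k) ℕ.+ j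
      lengths = ℕSolver.solve-∀

    inner< : length (bs ++ b ∷ []) ℕ.< length (as ++ a ∷ bs ++ b ∷ cs)
    inner< = <-fromExcess (length as ℕ.+ length cs) (≡.trans (length-repeat as a bs b cs)
      (≡.trans (lengths (length as) (length bs) (length cs))
        (cong (λ k → suc k ℕ.+ (length as ℕ.+ length cs)) (sym (length-++ bs)))))
      where
      lengths : ∀ i j k → i ℕ.+ suc (j ℕ.+ suc k) ≡ suc (j ℕ.+ 1) ℕ.+ (i ℕ.+ k)
      lengths = ℕSolver.solve-∀

  -- Between the two traversals `bs` returns to `head a`, and after both the walk is back at
  -- `tail a`, so `bs` and `as ++ cs` are closed and the gains of `a` and `a ⁻¹` cancel. This covers
  -- walks such as `a ∷ a ⁻¹ ∷ []`, whose heads may be distinct although they are no circles.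
  gain-repeatedEdge : ∀ as a bs cs → ShorterClosed₀ B (length (as ++ a ∷ bs ++ a ⁻¹ ∷ cs)) →
    Walk B u (as ++ a ∷ bs ++ a ⁻¹ ∷ cs) u → gain Φ (as ++ a ∷ bs ++ a ⁻¹ ∷ cs) ≡ 0ℤ
  gain-repeatedEdge {B} {u} as a bs cs shorter p
    with p₁ , _ , p₂ , _ , p₃ ← walk-repeat⁻ as a bs (a ⁻¹) cs p = begin
      gain Φ (as ++ a ∷ bs ++ a ⁻¹ ∷ cs)
        ≡⟨ gain-repeat as a bs (a ⁻¹) cs ⟩
      gain Φ as + (φ a + (gain Φ bs + (φ (a ⁻¹) + gain Φ cs)))
        ≡⟨ cong (λ g → gain Φ as + (φ a + (gain Φ bs + (g + gain Φ cs)))) (φ-⁻¹ a) ⟩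
      gain Φ as + (φ a + (gain Φ bs + (- φ a + gain Φ cs)))
        ≡⟨ rearrange (gain Φ as) (φ a) (gain Φ bs) (gain Φ cs) ⟩
      (gain Φ as + gain Φ cs) + gain Φ bs
        ≡⟨ cong (λ g → g + gain Φ bs) (∑-++ as cs φ) ⟨
      gain Φ (as ++ cs) + gain Φ bs
        ≡⟨ cong₂ _+_ (shorter (as ++ cs) outer< outer) (shorter bs inner< p₂) ⟩
      0ℤ ∎
    where
    rearrange : ∀ r s t w → r + (s + (t + (- s + w))) ≡ (r + w) + t
    rearrange = ℤSolver.solve-∀

    outer : Walk B u (as ++ cs) u
    outer = walk-++⁺ as p₁ (subst (λ w → Walk B w cs u) (head-⁻¹ a) p₃)

    outer< : length (as ++ cs) ℕ.< length (as ++ a ∷ bs ++ a ⁻¹ ∷ cs)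
    outer< = <-fromExcess (suc (length bs)) (≡.trans (length-repeat as a bs (a ⁻¹) cs)
      (≡.trans (lengths (length as) (length bs) (length cs))
        (cong (λ k → suc k ℕ.+ suc (length bs)) (sym (length-++ as)))))
      where
      lengths : ∀ i j k → i ℕ.+ suc (j ℕ.+ suc k) ≡ suc (i ℕ.+ k) ℕ.+ suc j
      lengths = ℕSolver.solve-∀

    inner< : length bs ℕ.< length (as ++ a ∷ bs ++ a ⁻¹ ∷ cs)
    inner< = <-fromExcess (length as ℕ.+ suc (length cs))
      (≡.trans (length-repeat as a bs (a ⁻¹) cs)
        (lengths (length as) (length bs) (length cs)))
      where
      lengths : ∀ i j k → i ℕ.+ suc (j ℕ.+ suc k) ≡ suc j ℕ.+ (i ℕ.+ suc k)
      lengths = ℕSolver.solve-∀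

  module _ {B : Subset ∣E∣} (balanced : Balanced Φ B) where

    -- A closed walk that is not a circle visits a vertex twice or uses an edge twice; either way
    -- it decomposes into two shorter closed walks (and, if an edge is traversed in both
    -- directions, the two cancelling traversals).
    gain-closedWalk : ∀ as → Walk B u as u → gain Φ as ≡ 0ℤ
    gain-closedWalk as = byLength as (<-wellFounded (length as))
      where
      unrepeated : ∀ as → Unique (map head as) → Unique (map edge as) → Walk B u as u →
                   gain Φ as ≡ 0ℤ
      unrepeated []       _      _      _         = refl
      unrepeated (a ∷ as) heads! edges! (p , as∈) =
        balanced _ (a ∷ as) (mkCircle (λ ()) p heads! edges! as∈)

      byLength : ∀ as → Acc ℕ._<_ (length as) → Walk B u as u → gain Φ as ≡ 0ℤ
      byLength as (acc rec) p
        with unique⊎repeat Fin._≟_ head as | unique⊎repeat Fin._≟_ edge as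
      ... | inj₁ heads! | inj₁ edges! = unrepeated as heads! edges! p
      ... | inj₂ (repeat as a bs b cs eq) | _ =
        gain-repeatedHead as a bs b cs eq (λ ds ds< → byLength ds (rec ds<)) p
      ... | inj₁ _ | inj₂ (repeat as a bs b cs eq) with same-or-opposite a b eq
      -- An edge traversed twice in the same direction also repeats its head.
      ...   | inj₁ refl = gain-repeatedHead as a bs a cs refl (λ ds ds< → byLength ds (rec ds<)) p
      ...   | inj₂ refl = gain-repeatedEdge as a bs cs (λ ds ds< → byLength ds (rec ds<)) p

    -- One walk followed by the reverse of the other is closed.
    gain-unique : Walk B u as v → Walk B u bs v → gain Φ as ≡ gain Φ bs
    gain-unique {as = as} {bs = bs} p q with cs , r , eq ← walk-reverse bs q =
      ℤ.i-j≡0⇒i≡j (gain Φ as) (gain Φ bs) (begin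
        gain Φ as - gain Φ bs      ≡⟨ cong (λ g → gain Φ as + g) eq ⟨
        gain Φ as + gain Φ cs      ≡⟨ ∑-++ as cs φ ⟨
        gain Φ (as ++ cs)          ≡⟨ gain-closedWalk (as ++ cs) (walk-++⁺ as p r) ⟩
        0ℤ                         ∎)

  -- Serves twice: for the colorings x with `B ⊆ improper x`, and for the function `offset` from
  -- which they are rebuilt.
  Potential : Subset ∣E∣ → (V → ℤ) → Set
  Potential B x = ∀ a → edge a ∈ˢ B → x (head a) ≡ x (tail a) + φ a

  potential-walk : ∀ x → Potential B x → ∀ as → Walk B u as v → x v ≡ x u + gain Φ as
  potential-walk x pot []       (refl , _) = sym (ℤ.+-identityʳ (x _))
  potential-walk {v = v} x pot (a ∷ as) ((refl , p) , a∈ All.∷ as∈) = begin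
    x v                               ≡⟨ potential-walk x pot as (p , as∈) ⟩
    x (head a) + gain Φ as            ≡⟨ cong (λ g → g + gain Φ as) (pot a a∈) ⟩
    x (tail a) + φ a + gain Φ as      ≡⟨ ℤ.+-assoc (x (tail a)) (φ a) (gain Φ as) ⟩
    x (tail a) + gain Φ (a ∷ as)      ∎

  -- Components and heights.

  path-suffix : ∀ {z} as → IsPath Φ B u as v → z ∈ vertices Φ u as → ∃[ bs ] IsPath Φ B z bs v
  path-suffix as       p (here refl) = as , p
  path-suffix (a ∷ as) (mkPath (_ , p) (_ ∷ verts!) (_ All.∷ as∈)) (there z∈) =
    path-suffix as (mkPath p verts! as∈) z∈

  -- Loop erasure: if the new first vertex already occurs on the path found for the rest, only the
  -- part from that occurrence on is kept. The gain may change; where it matters, `gain-unique` or a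
  -- potential recovers it.
  walk⇒connected : ∀ as → Walk B u as v → Connected Φ B u v
  walk⇒connected []       (refl , _) = [] , mkPath refl (All.[] ∷ []) All.[]
  walk⇒connected (a ∷ as) ((refl , p) , a∈ All.∷ as∈)
    with bs , q@(mkPath q′ verts! bs∈) ← walk⇒connected as (p , as∈)
    with any? (tail a Fin.≟_) (vertices Φ (head a) bs)
  ... | yes tail∈ = path-suffix bs q tail∈
  ... | no  tail∉ = a ∷ bs , mkPath (refl , q′) (¬Any⇒All¬ _ tail∉ ∷ verts!) (a∈ All.∷ bs∈)

  connected-refl : Connected Φ B u u
  connected-refl = walk⇒connected [] (refl , All.[])

  connected-sym : Connected Φ B u v → Connected Φ B v u
  connected-sym (as , p) with bs , q , _ ← walk-reverse as (path⇒walk p) = walk⇒connected bs q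

  connected-trans : Connected Φ B u v → Connected Φ B v w → Connected Φ B u w
  connected-trans (as , p) (bs , q) =
    walk⇒connected (as ++ bs) (walk-++⁺ as (path⇒walk p) (path⇒walk q))

  ∈-component⁺ : Connected Φ B u v → v ∈ˢ component Φ B u
  ∈-component⁺ {B} {u} = ∈-tabulate⁺ (connected? Φ B u)

  ∈-component⁻ : v ∈ˢ component Φ B u → Connected Φ B u v
  ∈-component⁻ {B = B} {u} = ∈-tabulate⁻ (connected? Φ B u)

  component-cong : Connected Φ B u v → component Φ B u ≡ component Φ B v
  component-cong {B} {u} {v} c = Vec.tabulate-cong λ w →
    does-⇔ (mk⇔ (connected-trans (connected-sym c)) (connected-trans c))
           (connected? Φ B u w) (connected? Φ B v w)

  component-injective : component Φ B u ≡ component Φ B v → Connected Φ B u v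
  component-injective {v = v} eq = ∈-component⁻ (subst (v ∈ˢ_) (sym eq) (∈-component⁺ connected-refl))

  walk-connected : ∀ as → Walk B u as v → All (Connected Φ B u) (vertices Φ u as)
  walk-connected []       _ = connected-refl All.∷ All.[]
  walk-connected (a ∷ as) ((refl , p) , a∈ All.∷ as∈) = connected-refl All.∷
    All.map (connected-trans (walk⇒connected (a ∷ []) (edge-walk a a∈)))
            (walk-connected as (p , as∈))

  component∈π : ∀ B u → component Φ B u ∈ π Φ B
  component∈π B u = ∈-deduplicate⁺ _≟ˢ_ (∈-map⁺ (component Φ B) (∈-allFin u))

  π-component : ∀ {W} → W ∈ π Φ B → ∃[ u ] W ≡ component Φ B u
  π-component {B} W∈
    with u , _ , eq ← ∈-map⁻ (component Φ B) (∈-deduplicate⁻ _≟ˢ_ _ W∈) = u , eq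

  gain≤height : ∀ as → IsPath Φ B u as v → gain Φ as ≤ height Φ B (component Φ B u)
  gain≤height {B} {u} {v} as p = All.lookup (xs≤max 0ℤ _)
    (∈-map⁺ (λ (_ , as) → gain Φ as) (∈-filter⁺ (pathIn? Φ B (component Φ B u))
      (∈-cartesianProduct⁺ (∈-allFin u) (path⇒candidate Φ p))
      (All.map ∈-component⁺ (walk-connected as (path⇒walk p)) , v , p)))

  height-attained : ∀ {W} → W ∈ π Φ B →
    ∃[ u ] ∃[ as ] ∃[ v ] IsPath Φ B u as v × component Φ B u ≡ W × gain Φ as ≡ height Φ B W
  height-attained {B} {W} W∈ with u , eq ← π-component W∈ =
    attained (argmax-sel id 0ℤ (map pathGain paths))
    where
    pathGain : V × List (Oriented ∣E∣) → ℤ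
    pathGain (_ , as) = gain Φ as

    paths : List (V × List (Oriented ∣E∣))
    paths = filter (pathIn? Φ B W) (cartesianProduct (allFin ∣V∣) (candidates Φ))

    attained : height Φ B W ≡ 0ℤ ⊎ height Φ B W ∈ map pathGain paths →
      ∃[ u ] ∃[ as ] ∃[ v ] IsPath Φ B u as v × component Φ B u ≡ W × gain Φ as ≡ height Φ B W
    -- The maximum may be the default 0 of `max`; the empty path at a vertex of W attains it.
    attained (inj₁ h≡0) = u , [] , u , mkPath refl (All.[] ∷ []) All.[] , sym eq , sym h≡0
    attained (inj₂ h∈) with (t , as) , p∈ , h≡ ← ∈-map⁻ pathGain h∈
      with _ , (t∈ All.∷ _) , v , p ← ∈-filter⁻ (pathIn? Φ B W)
             {xs = cartesianProduct (allFin ∣V∣) (candidates Φ)} p∈ =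
        t , as , v , p ,
        ≡.trans (sym (component-cong (∈-component⁻ (subst (t ∈ˢ_) eq t∈)))) (sym eq) , sym h≡

  -- The set of improper edges.

  ImproperAt : Vec ℤ ∣V∣ → Oriented ∣E∣ → Set
  ImproperAt x a = Vec.lookup x (head a) ≡ Vec.lookup x (tail a) + φ a

  improperAt-⁻¹ : ∀ x a → ImproperAt x a → ImproperAt x (a ⁻¹)
  improperAt-⁻¹ x a eq = begin
    Vec.lookup x (head (a ⁻¹))                 ≡⟨ cong (Vec.lookup x) (head-⁻¹ a) ⟩
    Vec.lookup x (tail a)                      ≡⟨ i≡i+j-j (Vec.lookup x (tail a)) (φ a) ⟩
    Vec.lookup x (tail a) + φ a + - φ a        ≡⟨ cong₂ _+_ eq (φ-⁻¹ a) ⟨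
    Vec.lookup x (head a) + φ (a ⁻¹)           ∎

  improperAt? : ∀ x e → Dec (ImproperAt x (e , Sign.+))
  improperAt? x e = _ ℤ.≟ _

  -- Testing the positive orientation is enough, since by `improperAt-⁻¹` improperness passes to the
  -- opposite one.
  improper : Vec ℤ ∣V∣ → Subset ∣E∣
  improper x = Vec.tabulate (does ∘ improperAt? x)

  ∈-improper⁺ : ∀ x a → ImproperAt x a → edge a ∈ˢ improper x
  ∈-improper⁺ x (e , Sign.+) eq = ∈-tabulate⁺ (improperAt? x) eq
  ∈-improper⁺ x (e , Sign.-) eq = ∈-tabulate⁺ (improperAt? x) (improperAt-⁻¹ x (e , Sign.-) eq)

  improper-potential : ∀ x → Potential (improper x) (Vec.lookup x)
  improper-potential x (e , Sign.+) e∈ = ∈-tabulate⁻ (improperAt? x) e∈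
  improper-potential x (e , Sign.-) e∈ =
    improperAt-⁻¹ x (e , Sign.+) (∈-tabulate⁻ (improperAt? x) e∈)

  potential⇒⊆improper : ∀ x → Potential B (Vec.lookup x) → B ⊆ improper x
  potential⇒⊆improper x pot {e} e∈ = ∈-improper⁺ x (e , Sign.+) (pot (e , Sign.+) e∈)

  ⊆improper⇒potential : ∀ x → B ⊆ improper x → Potential B (Vec.lookup x)
  ⊆improper⇒potential x B⊆ a a∈ = improper-potential x a (B⊆ a∈)

  -- Around a circle x returns to its initial value, so the total change, which is the gain, is 0.
  improper-balanced : ∀ x → Balanced Φ (improper x)
  improper-balanced x u as (mkCircle _ p _ _ as∈) = identityʳ-unique (Vec.lookup x u) (gain Φ as)
    (sym (potential-walk (Vec.lookup x) (improper-potential x) as (p , as∈)))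
    where open import Algebra.Properties.AbelianGroup ℤ.+-0-abelianGroup using (identityʳ-unique)

  -- Along the path x changes by `φ a`, which is improperness of `a`. The empty path gives the case
  -- of a loop of gain 0.
  improper-closed : ∀ x → Closed Φ (improper x)
  improper-closed x a as p eq = ∈-improper⁺ x a
    (≡.trans (potential-walk (Vec.lookup x) (improper-potential x) as (path⇒walk p))
             (cong (λ g → Vec.lookup x (tail a) + g) eq))

  proper⇒improper≡⊥ : ∀ x → Proper Φ x → ⊥ ≡ improper x
  proper⇒improper≡⊥ x proper =
    sym (Empty-unique λ (e , e∈) → proper (e , Sign.+) (improper-potential x (e , Sign.+) e∈))

  improper≡⊥⇒proper : ∀ x → ⊥ ≡ improper x → Proper Φ x
  improper≡⊥⇒proper x eq a improperAt = ∉⊥ (subst (edge a ∈ˢ_) (sym eq) (∈-improper⁺ x a improperAt))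

  -- Counting the colorings whose improper set contains B.

  -- A coloring with B ⊆ improper x is determined on each block W by its value at the start of a
  -- path of maximal gain in W: the other values exceed it by an offset between 0 and h_B(W),
  -- with both bounds attained, so exactly the initial values in [m - h_B(W)] are admissible.
  module _ {B : Subset ∣E∣} (balanced : Balanced Φ B) (m : ℤ) where

    private
      Index : Set
      Index = Fin (length (π Φ B))

      block : Index → Subset ∣V∣
      block = lookup (π Φ B)

      highestPath : ∀ i → ∃[ u ] ∃[ as ] ∃[ v ]
        IsPath Φ B u as v × component Φ B u ≡ block i × gain Φ as ≡ height Φ B (block i)
      highestPath i = height-attained {B} (∈-lookup i)

      root top : Index → V
      root i = proj₁ (highestPath i)
      top i = proj₁ (proj₂ (proj₂ (highestPath i)))

      topPath : ∀ i → Connected Φ B (root i) (top i)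
      topPath i = proj₁ (proj₂ (highestPath i)) , proj₁ (proj₂ (proj₂ (proj₂ (highestPath i))))

      component-root : ∀ i → component Φ B (root i) ≡ block i
      component-root i = proj₁ (proj₂ (proj₂ (proj₂ (proj₂ (highestPath i)))))

      gain-topPath : ∀ i → gain Φ (proj₁ (topPath i)) ≡ height Φ B (block i)
      gain-topPath i = proj₂ (proj₂ (proj₂ (proj₂ (proj₂ (highestPath i)))))

      index : V → Index
      index v = Any.index (component∈π B v)

      block-index : ∀ v → block (index v) ≡ component Φ B v
      block-index v = sym (lookup-index (component∈π B v))

      index-unique : ∀ v i → component Φ B v ≡ block i → index v ≡ i
      index-unique v i eq =
        lookup-injective (deduplicate-! _≟ˢ_ (map (component Φ B) (allFin ∣V∣))) (≡.trans (block-index v) eq)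

      index-cong : ∀ u v → Connected Φ B u v → index u ≡ index v
      index-cong u v c =
        index-unique u (index v) (≡.trans (component-cong c) (sym (block-index v)))

      rootPath : ∀ v → Connected Φ B (root (index v)) v
      rootPath v = component-injective (≡.trans (component-root (index v)) (block-index v))

      -- The potential on B normalised to vanish at the root of every block.
      offset : V → ℤ
      offset v = gain Φ (proj₁ (rootPath v))

      -- The separate equation for `i` admits walks from `root i` to a vertex whose index is only
      -- provably `i`, such as `root i` or `top i`.
      offset-unique : ∀ {i} as v → index v ≡ i → Walk B (root i) as v → gain Φ as ≡ offset v
      offset-unique as v refl p =
        gain-unique balanced p (path⇒walk (proj₂ (rootPath v)))

      index-root : ∀ i → index (root i) ≡ i
      index-root i = index-unique (root i) i (component-root i)

      offset-root : ∀ i → offset (root i) ≡ 0ℤ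
      offset-root i = sym (offset-unique [] (root i) (index-root i) (refl , All.[]))

      index-step : ∀ a → edge a ∈ˢ B → index (head a) ≡ index (tail a)
      index-step a a∈ = sym (index-cong (tail a) (head a) (walk⇒connected (a ∷ []) (edge-walk a a∈)))

      -- The chosen path to `tail a`, prolonged by `a`, is a walk to `head a` but perhaps no path;
      -- here path independence is needed for walks.
      offset-step : Potential B offset
      offset-step a a∈ = begin
        offset (head a)
          ≡⟨ offset-unique (path ++ a ∷ []) (head a) (index-step a a∈)
               (walk-++⁺ path (path⇒walk (proj₂ (rootPath (tail a)))) (edge-walk a a∈)) ⟨
        gain Φ (path ++ a ∷ [])
          ≡⟨ ∑-++ path (a ∷ []) φ ⟩
        gain Φ path + (φ a + 0ℤ)
          ≡⟨ cong (λ g → gain Φ path + g) (ℤ.+-identityʳ (φ a)) ⟩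
        gain Φ path + φ a ∎
        where
        path : List (Oriented ∣E∣)
        path = proj₁ (rootPath (tail a))

      height-block : Index → ℤ
      height-block i = height Φ B (block i)

      offset≤height : ∀ v → offset v ≤ height-block (index v)
      offset≤height v = subst (λ W → offset v ≤ height Φ B W) (component-root (index v))
        (gain≤height _ (proj₂ (rootPath v)))

      index-top : ∀ i → index (top i) ≡ i
      index-top i = ≡.trans (sym (index-cong (root i) (top i) (topPath i))) (index-root i)

      offset-top : ∀ i → offset (top i) ≡ height-block i
      offset-top i = ≡.trans
        (sym (offset-unique _ (top i) (index-top i) (path⇒walk (proj₂ (topPath i)))))
        (gain-topPath i)

      -- A path from `v` to the top has gain height minus `offset v`. By maximality this is at most
      -- the height.
      0≤offset : ∀ v → 0ℤ ≤ offset v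
      0≤offset v = subst (0ℤ ≤_)
        (≡.trans (cong (λ h → h - gain Φ path) height≡) (sym (i≡i+j-j (offset v) (gain Φ path))))
        (ℤ.i≤j⇒0≤j-i gain-path≤)
        where
        i : Index
        i = index v

        toTop : Connected Φ B v (top i)
        toTop = connected-trans (connected-sym (rootPath v)) (topPath i)

        path : List (Oriented ∣E∣)
        path = proj₁ toTop

        gain-path≤ : gain Φ path ≤ height-block i
        gain-path≤ = subst (λ W → gain Φ path ≤ height Φ B W) (sym (block-index v))
          (gain≤height path (proj₂ toTop))

        height≡ : height-block i ≡ offset v + gain Φ path
        height≡ = ≡.trans (sym (offset-top i))
          (potential-walk offset offset-step path (path⇒walk (proj₂ toTop)))

      coloring : Vec ℤ (length (π Φ B)) → Vec ℤ ∣V∣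
      coloring c = Vec.tabulate λ v → Vec.lookup c (index v) + offset v

      lookup-coloring : ∀ c v → Vec.lookup (coloring c) v ≡ Vec.lookup c (index v) + offset v
      lookup-coloring c = Vec.lookup∘tabulate _

      lookup-coloring-root : ∀ c i → Vec.lookup (coloring c) (root i) ≡ Vec.lookup c i
      lookup-coloring-root c i = begin
        Vec.lookup (coloring c) (root i)
          ≡⟨ lookup-coloring c (root i) ⟩
        Vec.lookup c (index (root i)) + offset (root i)
          ≡⟨ cong₂ _+_ (cong (Vec.lookup c) (index-root i)) (offset-root i) ⟩
        Vec.lookup c i + 0ℤ
          ≡⟨ ℤ.+-identityʳ _ ⟩
        Vec.lookup c i ∎

      coloring-injective : ∀ {c d} → coloring c ≡ coloring d → c ≡ d
      coloring-injective {c} {d} eq = begin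
        c                              ≡⟨ Vec.tabulate∘lookup c ⟨
        Vec.tabulate (Vec.lookup c)    ≡⟨ Vec.tabulate-cong same ⟩
        Vec.tabulate (Vec.lookup d)    ≡⟨ Vec.tabulate∘lookup d ⟩
        d                              ∎
        where
        same : ∀ i → Vec.lookup c i ≡ Vec.lookup d i
        same i = ≡.trans (sym (lookup-coloring-root c i))
          (≡.trans (cong (λ x → Vec.lookup x (root i)) eq) (lookup-coloring-root d i))

      coloring-potential : ∀ c → Potential B (Vec.lookup (coloring c))
      coloring-potential c a a∈ = begin
        Vec.lookup (coloring c) (head a)
          ≡⟨ lookup-coloring c (head a) ⟩
        Vec.lookup c (index (head a)) + offset (head a)
          ≡⟨ cong₂ _+_ (cong (Vec.lookup c) (index-step a a∈)) (offset-step a a∈) ⟩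
        Vec.lookup c (index (tail a)) + (offset (tail a) + φ a)
          ≡⟨ ℤ.+-assoc (Vec.lookup c (index (tail a))) (offset (tail a)) (φ a) ⟨
        Vec.lookup c (index (tail a)) + offset (tail a) + φ a
          ≡⟨ cong (λ y → y + φ a) (lookup-coloring c (tail a)) ⟨
        Vec.lookup (coloring c) (tail a) + φ a ∎

      lookup-potential : ∀ x → Potential B (Vec.lookup x) → ∀ v →
                         Vec.lookup x v ≡ Vec.lookup x (root (index v)) + offset v
      lookup-potential x pot v =
        potential-walk (Vec.lookup x) pot _ (path⇒walk (proj₂ (rootPath v)))

      range : Subset ∣V∣ → List ℤ
      range W = [1⋯ m - height Φ B W ]

      admissible : List (Vec ℤ (length (π Φ B)))
      admissible = choices (range ∘ block)

      satisfying : List (Vec ℤ ∣V∣)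
      satisfying = filter (λ x → B ⊆? improper x) (vectors ∣V∣ [1⋯ m ])

      coloring-satisfies : ∀ {c} → c ∈ admissible → coloring c ∈ satisfying
      coloring-satisfies {c} c∈ = ∈-filter⁺ (λ x → B ⊆? improper x)
        (∈-vectors⁺ (coloring c) λ v →
          subst (_∈ [1⋯ m ]) (sym (lookup-coloring c v)) (∈-[1⋯]⁺ m (lower v) (upper v)))
        (potential⇒⊆improper (coloring c) (coloring-potential c))
        where
        bounds : ∀ i → 1ℤ ≤ Vec.lookup c i × Vec.lookup c i ≤ m - height-block i
        bounds i = ∈-[1⋯]⁻ _ (∈-choices⁻ c∈ i)

        lower : ∀ v → 1ℤ ≤ Vec.lookup c (index v) + offset v
        lower v = ℤ.+-mono-≤ (proj₁ (bounds (index v))) (0≤offset v)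

        upper : ∀ v → Vec.lookup c (index v) + offset v ≤ m
        upper v = ℤ.≤-trans (ℤ.+-mono-≤ (proj₂ (bounds (index v))) (offset≤height v))
          (ℤ.≤-reflexive (m-h+h≡m m (height-block (index v))))
          where
          m-h+h≡m : ∀ m h → m - h + h ≡ m
          m-h+h≡m = ℤSolver.solve-∀

      satisfying⇒coloring : ∀ {x} → x ∈ satisfying → x ∈ map coloring admissible
      satisfying⇒coloring {x} x∈ =
        subst (_∈ map coloring admissible) coloring-c≡x (∈-map⁺ coloring c∈)
        where
        x∈vectors : x ∈ vectors ∣V∣ [1⋯ m ]
        x∈vectors = proj₁ (∈-filter⁻ (λ x → B ⊆? improper x) {xs = vectors ∣V∣ [1⋯ m ]} x∈)

        pot : Potential B (Vec.lookup x)
        pot = ⊆improper⇒potential x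
          (proj₂ (∈-filter⁻ (λ x → B ⊆? improper x) {xs = vectors ∣V∣ [1⋯ m ]} x∈))

        bounds : ∀ v → 1ℤ ≤ Vec.lookup x v × Vec.lookup x v ≤ m
        bounds v = ∈-[1⋯]⁻ m (∈-vectors⁻ x∈vectors v)

        c : Vec ℤ (length (π Φ B))
        c = Vec.tabulate λ i → Vec.lookup x (root i)

        lookup-c : ∀ i → Vec.lookup c i ≡ Vec.lookup x (root i)
        lookup-c = Vec.lookup∘tabulate _

        lookup-top : ∀ i → Vec.lookup x (top i) ≡ Vec.lookup x (root i) + height-block i
        lookup-top i = ≡.trans (lookup-potential x pot (top i))
          (cong₂ (λ j h → Vec.lookup x (root j) + h) (index-top i) (offset-top i))

        -- At the top of the block x exceeds its root value by the full height and is still at most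
        -- m.
        upper : ∀ i → Vec.lookup x (root i) ≤ m - height-block i
        upper i = ℤ.≤-trans (ℤ.≤-reflexive (i≡i+j-j (Vec.lookup x (root i)) (height-block i)))
          (ℤ.+-monoˡ-≤ (- height-block i)
            (subst (_≤ m) (lookup-top i) (proj₂ (bounds (top i)))))

        c∈ : c ∈ admissible
        c∈ = ∈-choices⁺ c λ i → subst (_∈ range (block i)) (sym (lookup-c i))
          (∈-[1⋯]⁺ _ (proj₁ (bounds (root i))) (upper i))

        coloring-c≡x : coloring c ≡ x
        coloring-c≡x = ≡.trans (Vec.tabulate-cong λ v →
            ≡.trans (cong (λ y → y + offset v) (lookup-c (index v))) (sym (lookup-potential x pot v)))
          (Vec.tabulate∘lookup x)

      satisfying-↭ : satisfying ↭ map coloring admissible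
      satisfying-↭ = ↭-fromUnique
        (Unique.filter⁺ (λ x → B ⊆? improper x) (vectors-unique ∣V∣ ([1⋯]-unique m)))
        (Unique.map⁺ coloring-injective (choices-unique (λ i → [1⋯]-unique (m - height-block i))))
        satisfying⇒coloring
        λ x∈ → let c , c∈ , eq = ∈-map⁻ coloring x∈ in
          subst (_∈ satisfying) (sym eq) (coloring-satisfies c∈)

    count-improper⊇ : + length (filter (λ x → B ⊆? improper x) (vectors ∣V∣ [1⋯ m ])) ≡
                      ∏ (π Φ B) (λ W → (m - height Φ B W) ⁺)
    count-improper⊇ = begin
      + length satisfying
        ≡⟨ cong +_ (↭-length satisfying-↭) ⟩
      + length (map coloring admissible)
        ≡⟨ cong +_ (length-map coloring admissible) ⟩
      + length admissible
        ≡⟨ length-choices (π Φ B) range ⟩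
      ∏ (π Φ B) (λ W → + length (range W))
        ≡⟨ cong (foldr _*_ 1ℤ) (map-cong (λ W → length-[1⋯] (m - height Φ B W)) (π Φ B)) ⟩
      ∏ (π Φ B) (λ W → (m - height Φ B W) ⁺) ∎

  -- Möbius sums over the lattice and the formula.

  Latᵇ-unique : Unique (Latᵇ Φ)
  Latᵇ-unique = Unique.filter⁺ (λ B → balanced? Φ B ×-dec closed? Φ B) (subsets-unique ∣E∣)

  ∈-Latᵇ⁺ : Balanced Φ B → Closed Φ B → B ∈ Latᵇ Φ
  ∈-Latᵇ⁺ {B} bal cl =
    ∈-filter⁺ (λ B → balanced? Φ B ×-dec closed? Φ B) (∈-subsets B) (bal , cl)

  ∈-Latᵇ⁻ : B ∈ Latᵇ Φ → Balanced Φ B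
  ∈-Latᵇ⁻ B∈ = proj₁ (proj₂
    (∈-filter⁻ (λ B → balanced? Φ B ×-dec closed? Φ B) {xs = subsets ∣E∣} B∈))

  𝟙-proper : ∀ x →
    𝟙 (proper? Φ x) ≡ ∑ (Latᵇ Φ) (λ B → möbius (Latᵇ Φ) ⊥ B * 𝟙 (B ⊆? improper x))
  𝟙-proper x = begin
    𝟙 (proper? Φ x)
      ≡⟨ 𝟙-cong (proper⇒improper≡⊥ x) (improper≡⊥⇒proper x) (proper? Φ x) (⊥ ≟ˢ improper x) ⟩
    𝟙 (⊥ ≟ˢ improper x)
      ≡⟨ ∑-möbius Latᵇ-unique ⊥ (∈-Latᵇ⁺ (improper-balanced x) (improper-closed x)) ⊥⊆ ⟨
    ∑ (filter (interval? ⊥ (improper x)) (Latᵇ Φ)) (möbius (Latᵇ Φ) ⊥)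
      -- The lower bound ∅ holds for every B, so the interval from ∅ to I(x) is the condition B ⊆
      -- I(x) alone.
      ≡⟨ cong (λ Bs → ∑ Bs (möbius (Latᵇ Φ) ⊥))
           (filter-≐ (interval? ⊥ (improper x)) (_⊆? improper x)
             ((λ (_ , B⊆) {e} → B⊆ {e}) , λ B⊆ → ⊥⊆ , λ {e} → B⊆ {e}) (Latᵇ Φ)) ⟩
    ∑ (filter (_⊆? improper x) (Latᵇ Φ)) (möbius (Latᵇ Φ) ⊥)
      ≡⟨ ∑-filter (_⊆? improper x) (Latᵇ Φ) ⟩
    ∑ (Latᵇ Φ) (λ B → möbius (Latᵇ Φ) ⊥ B * 𝟙 (B ⊆? improper x)) ∎

  μ∅≡möbius : Closed Φ ⊥ → ∀ B → μ∅ Φ B ≡ möbius (Latᵇ Φ) ⊥ B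
  μ∅≡möbius closed B = cong (if_then möbius (Latᵇ Φ) ⊥ B else 0ℤ) (dec-true (closed? Φ ⊥) closed)

  μ∅≡0 : ¬ Closed Φ ⊥ → ∀ B → μ∅ Φ B ≡ 0ℤ
  μ∅≡0 ¬closed B = cong (if_then möbius (Latᵇ Φ) ⊥ B else 0ℤ) (dec-false (closed? Φ ⊥) ¬closed)

  module _ (m : ℤ) where

    private
      L = Latᵇ Φ
      X = vectors ∣V∣ [1⋯ m ]
      μ = möbius L ⊥

      blockProduct : Subset ∣E∣ → ℤ
      blockProduct B = ∏ (π Φ B) (λ W → (m - height Φ B W) ⁺)

    χᶻ-möbius : + χᶻ Φ m ≡ ∑ L (λ B → μ B * blockProduct B)
    χᶻ-möbius = begin
      + χᶻ Φ m
        ≡⟨ length-filter (proper? Φ) X ⟩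
      ∑ X (𝟙 ∘ proper? Φ)
        ≡⟨ ∑-cong {xs = X} (λ {x} _ → 𝟙-proper x) ⟩
      ∑ X (λ x → ∑ L (λ B → μ B * 𝟙 (B ⊆? improper x)))
        ≡⟨ ∑-comm X L (λ x B → μ B * 𝟙 (B ⊆? improper x)) ⟩
      ∑ L (λ B → ∑ X (λ x → μ B * 𝟙 (B ⊆? improper x)))
        -- Membership in the lattice supplies the balance of B on which the count depends.
        ≡⟨ ∑-cong {xs = L} (λ {B} B∈ → count B (∈-Latᵇ⁻ B∈)) ⟩
      ∑ L (λ B → μ B * blockProduct B) ∎
      where
      count : ∀ B → Balanced Φ B → ∑ X (λ x → μ B * 𝟙 (B ⊆? improper x)) ≡ μ B * blockProduct B
      count B bal = begin
        ∑ X (λ x → μ B * 𝟙 (B ⊆? improper x))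
          ≡⟨ ∑-*ˡ X (μ B) (λ x → 𝟙 (B ⊆? improper x)) ⟩
        μ B * ∑ X (λ x → 𝟙 (B ⊆? improper x))
          ≡⟨ cong (μ B *_) (length-filter (λ x → B ⊆? improper x) X) ⟨
        μ B * + length (filter (λ x → B ⊆? improper x) X)
          ≡⟨ cong (μ B *_) (count-improper⊇ bal m) ⟩
        μ B * blockProduct B ∎

    χᶻ-⊥-not-closed : ¬ Closed Φ ⊥ → χᶻ Φ m ≡ 0
    χᶻ-⊥-not-closed ¬closed = cong length (filter-none (proper? Φ) {xs = X}
      (All.tabulate λ {x} _ proper →
        ¬closed (subst (Closed Φ) (sym (proper⇒improper≡⊥ x proper)) (improper-closed x))))

theorem3p1 : (Φ : GainGraph) (m : ℤ) →
    + χᶻ Φ m ≡ ∑ (Latᵇ Φ) (λ B → μ∅ Φ B * ∏ (π Φ B) (λ W → (m - height Φ B W) ⁺))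
theorem3p1 Φ m = byClosedness (closed? Φ ⊥)
  where
  blockProduct : Subset (GainGraph.∣E∣ Φ) → ℤ
  blockProduct B = ∏ (π Φ B) (λ W → (m - height Φ B W) ⁺)

  byClosedness : Dec (Closed Φ ⊥) → + χᶻ Φ m ≡ ∑ (Latᵇ Φ) (λ B → μ∅ Φ B * blockProduct B)
  byClosedness (yes closed) = ≡.trans (χᶻ-möbius Φ m)
    (∑-cong {xs = Latᵇ Φ} λ {B} _ → cong (_* blockProduct B) (sym (μ∅≡möbius Φ closed B)))
  byClosedness (no ¬closed) = begin
    + χᶻ Φ m
      ≡⟨ cong +_ (χᶻ-⊥-not-closed Φ m ¬closed) ⟩
    0ℤ
      ≡⟨ ∑-zero (Latᵇ Φ) ⟨
    ∑ (Latᵇ Φ) (λ _ → 0ℤ)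
      ≡⟨ ∑-cong {xs = Latᵇ Φ} (λ {B} _ → cong (_* blockProduct B) (μ∅≡0 Φ ¬closed B)) ⟨
    ∑ (Latᵇ Φ) (λ B → μ∅ Φ B * blockProduct B) ∎
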